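{- Let $n\ge 2$ be an integer, let $\epsilon>0$ be real, and let $G$ be the adjacency matrix of a simple directed graph on $n$ vertices. Then $$\max_{Q\in Q_t\cup Q_{nt}}\langle G,Q\rangle=n(1+\epsilon)$$ if and only if the graph $G$ is Hamiltonian.
   Context: A simple directed graph on vertices $1,\dots,n$ has no loops and no multiple arcs (both arcs $(i,j)$ and $(j,i)$ with $i\neq j$ may be present); it is identified with its $n\times n$ $0/1$ adjacency matrix $G$, which has zero diagonal. It is Hamiltonian if it contains a directed cycle through all $n$ vertices. For $n\times n$ real matrices, $\langle A,B\rangle=\sum_{i,j}A[i,j]B[i,j]$. $P$ is the set of all $n!$ permutation matrices of size $n\times n$. $P_t\subset P$ is the set of the $(n-1)!$ permutation matrices of $n$-cycles ("tours": viewed as adjacency matrices, they are directed Hamilton cycles), and $P_{nt}=P\setminus P_t$ ("non-tours"). Let $\overline{B_n}$ be the $n\times n$ matrix with all entries equal to $1/n$. Define $$Q_t=\{(1+\epsilon)X : X\in P_t\},\qquad Q_{nt}=\{X+\epsilon\,\overline{B_n} : X\in P_{nt}\}.$$ -}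

module Defs where

open import Level using (Level; _⊔_) renaming (suc to lsuc)
open import Algebra.Apartness.Bundles using (HeytingField; HeytingCommutativeRing)
open import Algebra.Bundles using (CommutativeRing)
open import Data.Bool.Base using (Bool; true; false; if_then_else_)
open import Data.Fin.Base using (Fin; toℕ)
open import Data.Fin.Permutation using (Permutation′; _⟨$⟩ʳ_)
open import Data.Fin.Properties using (_≟_)
open import Data.Nat.Base as ℕ using (ℕ; zero; suc)
open import Data.Nat.DivMod using (_mod_)
open import Data.Product.Base using (Σ-syntax; ∃-syntax; _×_; _,_; proj₁; proj₂)
open import Data.Sum.Base using (_⊎_; inj₁; inj₂)
open import Relation.Binary.Core using (Rel)
open import Relation.Binary.PropositionalEquality.Core using (_≡_)
open import Relation.Binary.Structures using (IsStrictPartialOrder)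
open import Relation.Nullary.Decidable.Core using (does)
open import Relation.Nullary.Negation.Core using (¬_)
open import Relation.Unary using (Pred; _∈_; _∩_; ∁)
import Algebra.Apartness.Properties.HeytingCommutativeRing as HeytingProperties
import Algebra.Definitions.RawMonoid as RawMonoidDefinitions
import Algebra.Properties.CommutativeMonoid.Sum as Sum
import Algebra.Properties.Ring as RingProperties

-- The real numbers, axiomatised as a Cauchy-complete Archimedean ordered
-- field.  The axioms are constructive: < need not be decidable, and its
-- comparison law is cotransitivity of _#_ together with #⇒<>.  Classically
-- they characterise ℝ up to isomorphism.
record RealField c ℓ₁ ℓ₂ : Set (lsuc (c ⊔ ℓ₁ ⊔ ℓ₂)) where
  infix 4 _<_ _≤_ _⟶_

  field
    heytingField : HeytingField c ℓ₁ ℓ₂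

  open HeytingField heytingField public

  field
    _<_                  : Rel Carrier ℓ₂
    isStrictPartialOrder : IsStrictPartialOrder _≈_ _<_
    #⇒<>                 : ∀ {x y} → x # y → x < y ⊎ y < x
    <⇒#                  : ∀ {x y} → x < y → x # y
    +-monoˡ-<            : ∀ {x y} z → x < y → x + z < y + z
    *-pos                : ∀ {x y} → 0# < x → 0# < y → 0# < x * y

  commutativeRing : CommutativeRing c ℓ₁
  commutativeRing = HeytingCommutativeRing.commutativeRing heytingCommutativeRing

  open CommutativeRing commutativeRing public
    using (+-rawMonoid; +-commutativeMonoid; ring)
  open RawMonoidDefinitions +-rawMonoid public
    using () renaming (_×_ to _·_)

  fromℕ : ℕ → Carrier
  fromℕ n = n · 1#

  _≤_ : Rel Carrier ℓ₂
  x ≤ y = ¬ (y < x)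

  -- The defining inequality is symmetric in m and n, so it says
  -- |x m - x n| < δ.
  Cauchy : (ℕ → Carrier) → Set (c ⊔ ℓ₂)
  Cauchy x = ∀ δ → 0# < δ →
    ∃[ N ] (∀ m n → N ℕ.≤ m → N ℕ.≤ n → x m < x n + δ)

  _⟶_ : (ℕ → Carrier) → Carrier → Set (c ⊔ ℓ₂)
  x ⟶ l = ∀ δ → 0# < δ →
    ∃[ N ] (∀ n → N ℕ.≤ n → (x n < l + δ) × (l < x n + δ))

  field
    archimedean : ∀ x → ∃[ n ] (x < fromℕ n)
    complete    : ∀ x → Cauchy x → ∃[ l ] (x ⟶ l)

  open IsStrictPartialOrder isStrictPartialOrder public
    using (<-respʳ-≈; <-respˡ-≈)
    renaming (irrefl to <-irrefl; trans to <-trans)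

  open HeytingProperties heytingCommutativeRing public
    using (1#0; x-0≈x)
  open RingProperties ring using (-1*x≈-x; -‿involutive)

  0<1 : 0# < 1#
  0<1 with #⇒<> 1#0
  ... | inj₂ 0<1 = 0<1
  ... | inj₁ 1<0 = <-respʳ-≈ (trans (-1*x≈-x _) (-‿involutive 1#)) (*-pos 0<-1 0<-1)
    where
    0<-1 : 0# < - 1#
    0<-1 = <-respˡ-≈ (-‿inverseʳ 1#)
             (<-respʳ-≈ (+-identityˡ (- 1#)) (+-monoˡ-< (- 1#) 1<0))

  0<fromℕ : ∀ m → 0# < fromℕ (suc m)
  0<fromℕ zero    = <-respʳ-≈ (sym (+-identityʳ 1#)) 0<1
  0<fromℕ (suc m) = <-trans (0<fromℕ m)
    (<-respˡ-≈ (+-identityˡ _) (+-monoˡ-< (fromℕ (suc m)) 0<1))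

  fromℕ#0 : ∀ m → fromℕ (suc m) # 0#
  fromℕ#0 m = #-sym (<⇒# (0<fromℕ m))

  1/suc : ℕ → Carrier
  1/suc m = proj₁ (#⇒invertible (fromℕ#0 m))

  1/suc-inverse : ∀ m → fromℕ (suc m) * 1/suc m ≈ 1#
  1/suc-inverse m = trans (*-congʳ (sym (x-0≈x _))) (proj₂ (proj₂ (#⇒invertible (fromℕ#0 m))))

-- Cyclic successor i ↦ i + 1 (mod n).
next : ∀ {n} → Fin n → Fin n
next {suc m} i = suc (toℕ i) mod suc m

record SimpleDigraph (n : ℕ) : Set where
  field
    arc      : Fin n → Fin n → Bool
    loopless : ∀ i → arc i i ≡ false

open SimpleDigraph public

-- The permutation v lists the vertices in the order in which the cycle
-- visits them.
Hamiltonian : ∀ {n} → SimpleDigraph n → Set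
Hamiltonian {n} G =
  Σ[ v ∈ Permutation′ n ] (∀ i → arc G (v ⟨$⟩ʳ i) (v ⟨$⟩ʳ next i) ≡ true)

-- σ = (a₀ a₁ … aₙ₋₁) in cycle notation, for some listing a of all n points.
IsNCycle : ∀ {n} → Permutation′ n → Set
IsNCycle {n} σ =
  Σ[ a ∈ Permutation′ n ] (∀ i → σ ⟨$⟩ʳ (a ⟨$⟩ʳ i) ≡ a ⟨$⟩ʳ next i)

module Matrices {c ℓ₁ ℓ₂ : Level} (ℝ : RealField c ℓ₁ ℓ₂) where
  open RealField ℝ
  open Sum +-commutativeMonoid using (sum)

  infix  4 _≋_
  infixl 6 _⊕_
  infixl 7 _⊛_

  Matrix : ℕ → Set c
  Matrix n = Fin n → Fin n → Carrier

  _≋_ : ∀ {n} → Rel (Matrix n) ℓ₁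
  A ≋ B = ∀ i j → A i j ≈ B i j

  _⊕_ : ∀ {n} → Matrix n → Matrix n → Matrix n
  (A ⊕ B) i j = A i j + B i j

  _⊛_ : ∀ {n} → Carrier → Matrix n → Matrix n
  (x ⊛ A) i j = x * A i j

  ⟨_,_⟩ : ∀ {n} → Matrix n → Matrix n → Carrier
  ⟨ A , B ⟩ = sum λ i → sum λ j → A i j * B i j

  indicator : Bool → Carrier
  indicator b = if b then 1# else 0#

  adjacency : ∀ {n} → SimpleDigraph n → Matrix n
  adjacency G i j = indicator (arc G i j)

  permutationMatrix : ∀ {n} → Permutation′ n → Matrix n
  permutationMatrix σ i j = indicator (does (σ ⟨$⟩ʳ i ≟ j))

  P : ∀ {n} → Pred (Matrix n) ℓ₁
  P {n} X = Σ[ σ ∈ Permutation′ n ] (X ≋ permutationMatrix σ)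

  Pₜ : ∀ {n} → Pred (Matrix n) ℓ₁
  Pₜ {n} X = Σ[ σ ∈ Permutation′ n ] (IsNCycle σ × X ≋ permutationMatrix σ)

  Pₙₜ : ∀ {n} → Pred (Matrix n) ℓ₁
  Pₙₜ = P ∩ ∁ Pₜ

  B̄ : ∀ {n} → Matrix n
  B̄ {suc m} i j = 1/suc m

  Qₜ : ∀ {n} → Carrier → Pred (Matrix n) (c ⊔ ℓ₁)
  Qₜ ε Q = ∃[ X ] (X ∈ Pₜ × Q ≋ (1# + ε) ⊛ X)

  Qₙₜ : ∀ {n} → Carrier → Pred (Matrix n) (c ⊔ ℓ₁)
  Qₙₜ ε Q = ∃[ X ] (X ∈ Pₙₜ × Q ≋ X ⊕ ε ⊛ B̄)

  -- max { f Q ∣ Q ∈ S } = v : the value v is attained and is an upper bound.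
  IsMaximum : ∀ {n ℓ} → (Matrix n → Carrier) → Pred (Matrix n) ℓ →
              Carrier → Set (c ⊔ ℓ₁ ⊔ ℓ₂ ⊔ ℓ)
  IsMaximum f S v =
    (∃[ Q ] (Q ∈ S × f Q ≈ v)) × (∀ Q → Q ∈ S → f Q ≤ v)

{-# OPTIONS --safe #-}

-- Write ⟨G,Q⟩ as a sum of row contributions and compare it with the sum of n
-- copies of 1 + ε.  For a tour σ the row i contributes 1 + ε or 0, according to
-- whether i → σ i is an arc, so the total is at most n(1 + ε), with equality
-- exactly when σ runs along arcs of G.  For a non-tour the row i contributes at
-- most 1 from the permutation, and strictly less than ε from εB̄ because the
-- diagonal entry of G vanishes; hence a non-tour never attains n(1 + ε).
module Submission where

open import Defs
open import Data.Bool.Base using (true; false)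
import Data.Bool.Properties as Bool
open import Data.Fin.Base as Fin using (Fin; zero; suc; toℕ; inject₁)
open import Data.Fin.Permutation
  using (Permutation′; permutation; flip; _∘ₚ_; _⟨$⟩ʳ_; _⟨$⟩ˡ_; inverseˡ; inverseʳ)
open import Data.Fin.Properties
  using (_≟_; toℕ-fromℕ; toℕ-fromℕ<; toℕ-inject₁; toℕ-injective; toℕ<n)
open import Data.Fin.Relation.Unary.Top using (view; ‵fromℕ; ‵inject₁)
open import Data.Nat.Base using (ℕ; zero; suc; _≥_)
open import Data.Nat.DivMod using (_%_; m%n<n; m<n⇒m%n≡m; n%n≡0)
open import Data.Product.Base using (_,_)
open import Data.Sum.Base using (inj₁; inj₂)
open import Function.Base using (_∘_)
open import Function.Bundles using (_⇔_; mk⇔)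
open import Relation.Binary.Bundles using (StrictPartialOrder)
open import Relation.Binary.PropositionalEquality.Core as ≡ using (_≡_; cong; subst)
open import Relation.Nullary.Decidable.Core using (does)
open import Relation.Nullary.Negation.Core using (contradiction)
open import Relation.Unary using (_∪_; _∈_)
open import Algebra.Bundles using (CommutativeRing)
import Algebra.Apartness.Properties.HeytingCommutativeRing as HeytingProperties
import Algebra.Properties.Semiring.Mult as SemiringMult
import Algebra.Properties.Semiring.Sum as SemiringSum
import Relation.Binary.Construct.StrictToNonStrict as StrictToNonStrict
import Relation.Binary.Reasoning.StrictPartialOrder as <-Reasoning

-- The cyclic successor as a permutation, and the cycles it induces.

toℕ-next : ∀ {m} (i : Fin (suc m)) → toℕ (next i) ≡ suc (toℕ i) % suc m
toℕ-next {m} i = toℕ-fromℕ< (m%n<n (suc (toℕ i)) (suc m))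

next-fromℕ : ∀ m → next (Fin.fromℕ m) ≡ zero
next-fromℕ m = toℕ-injective (≡.trans (toℕ-next (Fin.fromℕ m))
  (≡.trans (cong (λ k → suc k % suc m) (toℕ-fromℕ m)) (n%n≡0 (suc m))))

next-inject₁ : ∀ {m} (i : Fin m) → next (inject₁ i) ≡ suc i
next-inject₁ {m} i = toℕ-injective (≡.trans (toℕ-next (inject₁ i))
  (≡.trans (cong (λ k → suc k % suc m) (toℕ-inject₁ i)) (m<n⇒m%n≡m (toℕ<n (suc i)))))

-- Given by cases instead of modular arithmetic: its two values, the last index and an `inject₁`,
-- are exactly the arguments on which `next` has been evaluated, with and without wrap-around.
prev : ∀ {m} → Fin (suc m) → Fin (suc m)
prev {m} zero = Fin.fromℕ m
prev (suc i)  = inject₁ i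

next-prev : ∀ {m} (i : Fin (suc m)) → next (prev i) ≡ i
next-prev {m} zero = next-fromℕ m
next-prev (suc i)  = next-inject₁ i

prev-next : ∀ {m} (i : Fin (suc m)) → prev (next i) ≡ i
prev-next {m} i with view i
... | ‵fromℕ     = cong prev (next-fromℕ m)
... | ‵inject₁ j = cong prev (next-inject₁ j)

nextₚ : ∀ {m} → Permutation′ (suc m)
nextₚ = permutation next prev next-prev prev-next

-- The n-cycle (v₀ v₁ … vₙ₋₁).
cycle : ∀ {m} → Permutation′ (suc m) → Permutation′ (suc m)
cycle v = flip v ∘ₚ nextₚ ∘ₚ v

-- The listing is `v` itself: `flip v` returns the vertex at position `i` to `i`, then `nextₚ`
-- advances the position and `v` reads off the next vertex.
cycle-isNCycle : ∀ {m} (v : Permutation′ (suc m)) → IsNCycle (cycle v)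
cycle-isNCycle v = v , λ i → cong (λ j → v ⟨$⟩ʳ next j) (inverseˡ v)

-- Comparison of finite sums, and positivity of 1/n.

module OrderedFieldProperties {c ℓ₁ ℓ₂} (ℝ : RealField c ℓ₁ ℓ₂) where
  open RealField ℝ hiding (zero)
  open CommutativeRing commutativeRing using (semiring)
  open SemiringSum semiring
  open SemiringMult semiring using (×-assoc-*; ×-congʳ)
  open HeytingProperties heytingCommutativeRing using (invertibleˡ⇒#)

  <-strictPartialOrder : StrictPartialOrder c ℓ₁ ℓ₂
  <-strictPartialOrder = record { isStrictPartialOrder = isStrictPartialOrder }

  open <-Reasoning <-strictPartialOrder

  -- The constructive ≤ is the weaker ¬ (y < x); the sums below are compared
  -- through this decided version.
  open StrictToNonStrict _≈_ _<_ public using () renaming (_≤_ to _≲_)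

  ≲⇒≤ : ∀ {x y} → x ≲ y → x ≤ y
  ≲⇒≤ (inj₁ x<y) y<x = <-irrefl refl (<-trans x<y y<x)
  ≲⇒≤ (inj₂ x≈y) y<x = <-irrefl (sym x≈y) y<x

  +-monoʳ-< : ∀ {x y} z → x < y → z + x < z + y
  +-monoʳ-< z x<y = <-respʳ-≈ (+-comm _ z) (<-respˡ-≈ (+-comm _ z) (+-monoˡ-< z x<y))

  +-monoˡ-≲ : ∀ {x y} z → x ≲ y → x + z ≲ y + z
  +-monoˡ-≲ z (inj₁ x<y) = inj₁ (+-monoˡ-< z x<y)
  +-monoˡ-≲ z (inj₂ x≈y) = inj₂ (+-congʳ x≈y)

  +-monoʳ-≲ : ∀ {x y} z → x ≲ y → z + x ≲ z + y
  +-monoʳ-≲ z (inj₁ x<y) = inj₁ (+-monoʳ-< z x<y)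
  +-monoʳ-≲ z (inj₂ x≈y) = inj₂ (+-congˡ x≈y)

  sum-mono-≲ : ∀ {n} (f g : Fin n → Carrier) → (∀ i → f i ≲ g i) → sum f ≲ sum g
  sum-mono-≲ {zero}  f g f≲g = inj₂ refl
  sum-mono-≲ {suc n} f g f≲g = begin
    f zero + sum (f ∘ suc)  ≤⟨ +-monoˡ-≲ _ (f≲g zero) ⟩
    g zero + sum (f ∘ suc)  ≤⟨ +-monoʳ-≲ _ (sum-mono-≲ (f ∘ suc) (g ∘ suc) (f≲g ∘ suc)) ⟩
    g zero + sum (g ∘ suc)  ∎

  sum-mono-< : ∀ {n} (f g : Fin n → Carrier) → (∀ i → f i ≲ g i) →
               ∀ i → f i < g i → sum f < sum g
  sum-mono-< f g f≲g zero fi<gi = begin-strict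
    f zero + sum (f ∘ suc)  <⟨ +-monoˡ-< _ fi<gi ⟩
    g zero + sum (f ∘ suc)  ≤⟨ +-monoʳ-≲ _ (sum-mono-≲ (f ∘ suc) (g ∘ suc) (f≲g ∘ suc)) ⟩
    g zero + sum (g ∘ suc)  ∎
  sum-mono-< f g f≲g (suc i) fi<gi = begin-strict
    f zero + sum (f ∘ suc)  ≤⟨ +-monoˡ-≲ _ (f≲g zero) ⟩
    g zero + sum (f ∘ suc)  <⟨ +-monoʳ-< _ (sum-mono-< (f ∘ suc) (g ∘ suc) (f≲g ∘ suc) i fi<gi) ⟩
    g zero + sum (g ∘ suc)  ∎

  sum-const : ∀ n x → ∑[ i < n ] x ≈ fromℕ n * x
  sum-const n x = begin-equality
    ∑[ i < n ] x  ≈⟨ sum-replicate n ⟩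
    n · x         ≈⟨ ×-congʳ n (*-identityˡ x) ⟨
    n · (1# * x)  ≈⟨ ×-assoc-* n 1# x ⟨
    fromℕ n * x   ∎

  -- An invertible element is apart from zero. The apartness permits the case split on the sign of
  -- `1/suc m`, which an undecidable order does not give outright.
  1/suc#0 : ∀ m → 1/suc m # 0#
  1/suc#0 m = invertibleˡ⇒#
    (fromℕ (suc m) , trans (*-congˡ (x-0≈x (1/suc m))) (1/suc-inverse m))

  -- If `1/suc m` were negative, the sum of `suc m` copies of it would be negative as well, yet that
  -- sum is 1.
  0<1/suc : ∀ m → 0# < 1/suc m
  0<1/suc m with #⇒<> (1/suc#0 m)
  ... | inj₂ 0<u = 0<u
  ... | inj₁ u<0 = contradiction (<-trans 0<1 1<0) (<-irrefl refl)
    where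
    1<0 : 1# < 0#
    1<0 = begin-strict
      1#                       ≈⟨ 1/suc-inverse m ⟨
      fromℕ (suc m) * 1/suc m  ≈⟨ sum-const (suc m) (1/suc m) ⟨
      ∑[ i < suc m ] 1/suc m   <⟨ sum-mono-< {suc m} _ _ (λ _ → inj₁ u<0) zero u<0 ⟩
      ∑[ i < suc m ] 0#        ≈⟨ sum-replicate-zero (suc m) ⟩
      0#                       ∎

-- Inner products with permutation matrices.

module Weights {c ℓ₁ ℓ₂} (ℝ : RealField c ℓ₁ ℓ₂) where
  open RealField ℝ hiding (zero)
  open Matrices ℝ
  open OrderedFieldProperties ℝ
  open CommutativeRing commutativeRing using (semiring)
  open SemiringSum semiring
  open <-Reasoning <-strictPartialOrder

  indicator-≲1 : ∀ b → indicator b ≲ 1#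
  indicator-≲1 true  = inj₂ refl
  indicator-≲1 false = inj₁ 0<1

  indicator-*-< : ∀ {b x} → 0# < x → b ≡ false → indicator b * x < x
  indicator-*-< 0<x ≡.refl = <-respˡ-≈ (sym (zeroˡ _)) 0<x

  indicator-*-≲ : ∀ b {x} → 0# < x → indicator b * x ≲ x
  indicator-*-≲ true  0<x = inj₂ (*-identityˡ _)
  indicator-*-≲ false 0<x = inj₁ (indicator-*-< 0<x ≡.refl)

  indicator-*-≈ : ∀ {b x} → b ≡ true → indicator b * x ≈ x
  indicator-*-≈ ≡.refl = *-identityˡ _

  -- A permutation matrix has a single 1 in each row. Induction on `k` suffices because
  -- `does (k ≟ j)` computes on constructors: the head is selected, or it vanishes and the tail is
  -- the same sum for the predecessor.
  sum-select : ∀ {n} (f : Fin n → Carrier) k →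
               ∑[ j < n ] (f j * indicator (does (k ≟ j))) ≈ f k
  sum-select {suc n} f zero = begin-equality
    f zero * 1# + ∑[ j < n ] (f (suc j) * 0#)
      ≈⟨ +-cong (*-identityʳ _) (sum-cong-≋ (λ j → zeroʳ (f (suc j)))) ⟩
    f zero + ∑[ j < n ] 0#
      ≈⟨ +-congˡ (sum-replicate-zero n) ⟩
    f zero + 0#
      ≈⟨ +-identityʳ _ ⟩
    f zero ∎
  sum-select {suc n} f (suc k) = begin-equality
    f zero * 0# + ∑[ j < n ] (f (suc j) * indicator (does (k ≟ j)))
      ≈⟨ +-cong (zeroʳ _) (sum-select (f ∘ suc) k) ⟩
    0# + f (suc k)
      ≈⟨ +-identityˡ _ ⟩
    f (suc k) ∎

  ⟨,⟩-congˡ : ∀ {n} (A : Matrix n) {B C} → B ≋ C → ⟨ A , B ⟩ ≈ ⟨ A , C ⟩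
  ⟨,⟩-congˡ A B≋C = sum-cong-≋ λ i → sum-cong-≋ λ j → *-congˡ (B≋C i j)

  module _ {n} (G : SimpleDigraph n) (σ : Permutation′ n) where

    tour-weight : ∀ x → ⟨ adjacency G , x ⊛ permutationMatrix σ ⟩ ≈
                        ∑[ i < n ] (indicator (arc G i (σ ⟨$⟩ʳ i)) * x)
    tour-weight x = sum-cong-≋ λ i → begin-equality
      ∑[ j < n ] (adjacency G i j * (x * permutationMatrix σ i j))
        -- The scalar joins the entry of `G`, leaving a bare indicator for `sum-select`.
        ≈⟨ sum-cong-≋ (λ j → *-assoc (adjacency G i j) x (permutationMatrix σ i j)) ⟨
      ∑[ j < n ] (adjacency G i j * x * permutationMatrix σ i j)
        ≈⟨ sum-select (λ j → adjacency G i j * x) (σ ⟨$⟩ʳ i) ⟩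
      adjacency G i (σ ⟨$⟩ʳ i) * x ∎

    module _ {x} (0<x : 0# < x) where

      tour-weight-≲ : ⟨ adjacency G , x ⊛ permutationMatrix σ ⟩ ≲ fromℕ n * x
      tour-weight-≲ = begin
        ⟨ adjacency G , x ⊛ permutationMatrix σ ⟩
          ≈⟨ tour-weight x ⟩
        ∑[ i < n ] (indicator (arc G i (σ ⟨$⟩ʳ i)) * x)
          ≤⟨ sum-mono-≲ {n} _ _ (λ i → indicator-*-≲ (arc G i (σ ⟨$⟩ʳ i)) 0<x) ⟩
        ∑[ i < n ] x
          ≈⟨ sum-const n x ⟩
        fromℕ n * x ∎

      tour-weight-< : ∀ i → arc G i (σ ⟨$⟩ʳ i) ≡ false →
                      ⟨ adjacency G , x ⊛ permutationMatrix σ ⟩ < fromℕ n * x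
      tour-weight-< i no-arc = begin-strict
        ⟨ adjacency G , x ⊛ permutationMatrix σ ⟩
          ≈⟨ tour-weight x ⟩
        ∑[ i < n ] (indicator (arc G i (σ ⟨$⟩ʳ i)) * x)
          <⟨ sum-mono-< {n} _ _ (λ i → indicator-*-≲ (arc G i (σ ⟨$⟩ʳ i)) 0<x)
               i (indicator-*-< 0<x no-arc) ⟩
        ∑[ i < n ] x
          ≈⟨ sum-const n x ⟩
        fromℕ n * x ∎

      -- A missing arc would make the weight strictly smaller. Since `arc` is Boolean, refuting
      -- `false` already yields `true`.
      tour-weight-maximal⇒arcs :
        ⟨ adjacency G , x ⊛ permutationMatrix σ ⟩ ≈ fromℕ n * x →
        ∀ i → arc G i (σ ⟨$⟩ʳ i) ≡ true
      tour-weight-maximal⇒arcs w≈nx i = Bool.¬-not λ no-arc →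
        <-irrefl w≈nx (tour-weight-< i no-arc)

    arcs⇒tour-weight-maximal : ∀ x → (∀ i → arc G i (σ ⟨$⟩ʳ i) ≡ true) →
      ⟨ adjacency G , x ⊛ permutationMatrix σ ⟩ ≈ fromℕ n * x
    arcs⇒tour-weight-maximal x arcs = begin-equality
      ⟨ adjacency G , x ⊛ permutationMatrix σ ⟩
        ≈⟨ tour-weight x ⟩
      ∑[ i < n ] (indicator (arc G i (σ ⟨$⟩ʳ i)) * x)
        ≈⟨ sum-cong-≋ (λ i → indicator-*-≈ (arcs i)) ⟩
      ∑[ i < n ] x
        ≈⟨ sum-const n x ⟩
      fromℕ n * x ∎

  -- The strict bound for non-tours, and the equivalence.

  module _ {m} (G : SimpleDigraph (suc m)) where

    private
      n = suc m

    B̄-row-< : ∀ {ε} → 0# < ε → ∀ i → ∑[ j < n ] (adjacency G i j * (ε * 1/suc m)) < ε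
    B̄-row-< {ε} 0<ε i = begin-strict
      ∑[ j < n ] (adjacency G i j * (ε * 1/suc m))
        <⟨ sum-mono-< {n} _ _ (λ j → indicator-*-≲ (arc G i j) 0<ε/n)
             -- The strict term sits in column `i`, on the diagonal, where 0 replaces the positive
             -- ε/n.
             i (indicator-*-< 0<ε/n (loopless G i)) ⟩
      ∑[ j < n ] (ε * 1/suc m)
        ≈⟨ *-distribˡ-sum {n} ε (λ _ → 1/suc m) ⟨
      ε * ∑[ j < n ] 1/suc m
        ≈⟨ *-congˡ (trans (sum-const n (1/suc m)) (1/suc-inverse m)) ⟩
      ε * 1#
        ≈⟨ *-identityʳ ε ⟩
      ε ∎
      where
      0<ε/n : 0# < ε * 1/suc m
      0<ε/n = *-pos 0<ε (0<1/suc m)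

    non-tour-weight-< : ∀ {ε} → 0# < ε → (σ : Permutation′ n) →
      ⟨ adjacency G , permutationMatrix σ ⊕ ε ⊛ B̄ ⟩ < fromℕ n * (1# + ε)
    non-tour-weight-< {ε} 0<ε σ = begin-strict
      ⟨ adjacency G , permutationMatrix σ ⊕ ε ⊛ B̄ ⟩
        -- Every row is strict; row `zero`, present because `n` is a successor, serves as the
        -- witness.
        <⟨ sum-mono-< {n} _ _ (inj₁ ∘ row-<) zero (row-< zero) ⟩
      ∑[ i < n ] (1# + ε)
        ≈⟨ sum-const n (1# + ε) ⟩
      fromℕ n * (1# + ε) ∎
      where
      row-< : ∀ i → ∑[ j < n ] (adjacency G i j * (permutationMatrix σ i j + ε * 1/suc m))
                    < 1# + ε
      row-< i = begin-strict
        ∑[ j < n ] (adjacency G i j * (permutationMatrix σ i j + ε * 1/suc m))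
          ≈⟨ sum-cong-≋ (λ j → distribˡ (adjacency G i j) (permutationMatrix σ i j) (ε * 1/suc m)) ⟩
        ∑[ j < n ] (adjacency G i j * permutationMatrix σ i j + adjacency G i j * (ε * 1/suc m))
          ≈⟨ ∑-distrib-+ (λ j → adjacency G i j * permutationMatrix σ i j)
                         (λ j → adjacency G i j * (ε * 1/suc m)) ⟩
        ∑[ j < n ] (adjacency G i j * permutationMatrix σ i j)
          + ∑[ j < n ] (adjacency G i j * (ε * 1/suc m))
          ≈⟨ +-congʳ (sum-select (adjacency G i) (σ ⟨$⟩ʳ i)) ⟩
        adjacency G i (σ ⟨$⟩ʳ i) + ∑[ j < n ] (adjacency G i j * (ε * 1/suc m))
          ≤⟨ +-monoˡ-≲ _ (indicator-≲1 (arc G i (σ ⟨$⟩ʳ i))) ⟩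
        1# + ∑[ j < n ] (adjacency G i j * (ε * 1/suc m))
          <⟨ +-monoʳ-< 1# (B̄-row-< 0<ε i) ⟩
        1# + ε ∎

    module _ {ε} (0<ε : 0# < ε) where

      0<1+ε : 0# < 1# + ε
      0<1+ε = <-trans 0<1 (<-respˡ-≈ (+-identityʳ 1#) (+-monoʳ-< 1# 0<ε))

      -- Membership determines a matrix only up to `≋`; this passes to the explicit representative,
      -- to which the tour bounds apply.
      Qₜ-weight : ∀ {Q} ((X , (σ , _) , _) : Q ∈ Qₜ ε) →
        ⟨ adjacency G , Q ⟩ ≈ ⟨ adjacency G , (1# + ε) ⊛ permutationMatrix σ ⟩
      Qₜ-weight (X , (σ , _ , X≋σ) , Q≋) =
        ⟨,⟩-congˡ (adjacency G) λ i j → trans (Q≋ i j) (*-congˡ (X≋σ i j))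

      Qₜ-weight-≲ : ∀ {Q} → Q ∈ Qₜ ε → ⟨ adjacency G , Q ⟩ ≲ fromℕ n * (1# + ε)
      Qₜ-weight-≲ {Q} Q∈Qₜ@(_ , (σ , _) , _) = begin
        ⟨ adjacency G , Q ⟩
          ≈⟨ Qₜ-weight Q∈Qₜ ⟩
        ⟨ adjacency G , (1# + ε) ⊛ permutationMatrix σ ⟩
          ≤⟨ tour-weight-≲ G σ 0<1+ε ⟩
        fromℕ n * (1# + ε) ∎

      Qₙₜ-weight-< : ∀ {Q} → Q ∈ Qₙₜ ε → ⟨ adjacency G , Q ⟩ < fromℕ n * (1# + ε)
      Qₙₜ-weight-< {Q} (X , ((σ , X≋σ) , _) , Q≋) = begin-strict
        ⟨ adjacency G , Q ⟩
          ≈⟨ ⟨,⟩-congˡ (adjacency G) (λ i j → trans (Q≋ i j) (+-congʳ (X≋σ i j))) ⟩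
        ⟨ adjacency G , permutationMatrix σ ⊕ ε ⊛ B̄ ⟩
          <⟨ non-tour-weight-< 0<ε σ ⟩
        fromℕ n * (1# + ε) ∎

      maximum⇒Hamiltonian :
        IsMaximum (λ Q → ⟨ adjacency G , Q ⟩) (Qₜ ε ∪ Qₙₜ ε) (fromℕ n * (1# + ε)) →
        Hamiltonian G
      maximum⇒Hamiltonian ((Q , inj₂ Q∈Qₙₜ , Q-max) , _) =
        contradiction (Qₙₜ-weight-< Q∈Qₙₜ) (<-irrefl Q-max)
      maximum⇒Hamiltonian ((Q , inj₁ Q∈Qₜ@(_ , (σ , (a , σa≡a∘next) , _) , _) , Q-max) , _) =
        -- The listing `a` of the cycle `σ` is the Hamilton cycle: the arc from `a i` to `σ (a i)`
        -- joins consecutive vertices of it.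
        a , λ i → subst (λ j → arc G (a ⟨$⟩ʳ i) j ≡ true) (σa≡a∘next i) (arcs (a ⟨$⟩ʳ i))
        where
        arcs : ∀ i → arc G i (σ ⟨$⟩ʳ i) ≡ true
        arcs = tour-weight-maximal⇒arcs G σ 0<1+ε (trans (sym (Qₜ-weight Q∈Qₜ)) Q-max)

      Hamiltonian⇒maximum :
        Hamiltonian G →
        IsMaximum (λ Q → ⟨ adjacency G , Q ⟩) (Qₜ ε ∪ Qₙₜ ε) (fromℕ n * (1# + ε))
      Hamiltonian⇒maximum (v , v-arcs) =
        ( (1# + ε) ⊛ permutationMatrix σ
        , inj₁ ( permutationMatrix σ
               , (σ , cycle-isNCycle v , λ _ _ → refl)
               , λ _ _ → refl)
        , arcs⇒tour-weight-maximal G σ (1# + ε) arcs)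
        , λ { Q (inj₁ Q∈Qₜ)  → ≲⇒≤ (Qₜ-weight-≲ Q∈Qₜ)
            ; Q (inj₂ Q∈Qₙₜ) → ≲⇒≤ (inj₁ (Qₙₜ-weight-< Q∈Qₙₜ)) }
        where
        σ : Permutation′ n
        σ = cycle v

        arcs : ∀ i → arc G i (σ ⟨$⟩ʳ i) ≡ true
        -- At the position of `i` in `v`, the target of the arc is `σ i` by definition, so only the
        -- source needs rewriting.
        arcs i = subst (λ j → arc G j (σ ⟨$⟩ʳ i) ≡ true) (inverseʳ v) (v-arcs (v ⟨$⟩ˡ i))

lemma2p2 : ∀ {c ℓ₁ ℓ₂} (ℝ : RealField c ℓ₁ ℓ₂) →
    let open RealField ℝ
        open Matrices ℝ
    in
    (n : ℕ) → n ≥ 2 → (ε : Carrier) → 0# < ε → (G : SimpleDigraph n) →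
    IsMaximum (λ Q → ⟨ adjacency G , Q ⟩) (Qₜ ε ∪ Qₙₜ ε) (fromℕ n * (1# + ε))
      ⇔ Hamiltonian G
lemma2p2 ℝ (suc m) _ ε 0<ε G = mk⇔ (maximum⇒Hamiltonian G 0<ε) (Hamiltonian⇒maximum G 0<ε)
  where open Weights ℝ
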